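{- Let $G_1$ be the graph constructed as follows: take a star with centre $c$ and leaves $v_1,v_2,v_3,v_4$, and for each $i\in\{1,2,3,4\}$ take a copy $S_i$ of $S$ in which the vertex $a$ is identified with $c$ and the vertex $b$ is identified with $v_i$ (so the edge $ab$ of $S_i$ is the edge $cv_i$), the copies $S_1,\dots,S_4$ being otherwise vertex-disjoint. Then for every subgraph $H$ of $G_1$ with maximum degree $\Delta(H)\le 3$, the graph $G_1-E(H)$ is not $3$-choosable.
   Context: $J_3$ is the graph with vertex set $\{a,b,c,d,e,f,g,h,i,j,k\}$ and edges $ab$; $ac,ad,ae,af,ag$; $bc,bd,be,bf,bg$; $cd,de,ef,fg$; $ha,hd,he$; $ia,ie,if$; $jb,jd,je$; $kb,ke,kf$. $S$ is the graph obtained from nine pairwise vertex-disjoint copies of $J_3$ by identifying all copies of $a$ into a single vertex $a$ and all copies of $b$ into a single vertex $b$, all other vertices staying distinct. A graph is $3$-choosable if for every assignment of a list of $3$ colours to each vertex there is a proper colouring choosing each vertex's colour from its list. (The resulting graph $G_1$ is planar.) -}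

module Defs where

open import Data.Fin.Base using (Fin; zero; suc)
open import Data.Fin.Patterns
import Data.Fin.Properties as Fin
open import Data.List.Base
  using (List; []; _∷_; _++_; map; filter; length; concatMap; allFin; cartesianProduct)
open import Data.List.Extrema.Nat using (max)
open import Data.List.Membership.Propositional using (_∈_)
open import Data.List.Membership.Propositional.Properties
  using (∈-allFin; ∈-++⁺ˡ; ∈-++⁺ʳ; ∈-map⁺; ∈-map⁻; ∈-cartesianProduct⁺)
import Data.List.Membership.DecPropositional as DecMembership
open import Data.List.Relation.Unary.All as All using (All; []; _∷_)
import Data.List.Relation.Unary.All.Properties as All
open import Data.List.Relation.Unary.Unique.Propositional using (Unique)
import Data.List.Relation.Unary.Unique.Propositional.Properties as Unique
open import Data.Nat.Base using (ℕ)
open import Data.Product.Base as Product using (_×_; _,_; ∃; proj₁; proj₂; uncurry)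
import Data.Product.Properties as Product
open import Data.Sum.Base as Sum using (_⊎_; inj₁; inj₂)
import Data.Sum.Properties as Sum
open import Function.Base using (_∘_)
open import Function.Definitions using (Injective)
open import Level using (0ℓ)
open import Relation.Binary.Core using (Rel)
open import Relation.Binary.Definitions
  using (Decidable; DecidableEquality; Symmetric; Irreflexive)
open import Relation.Binary.PropositionalEquality using (_≡_; _≢_; refl; sym; trans)
open import Relation.Nullary.Decidable using (_×-dec_; _⊎-dec_; ¬?; from-yes)
open import Relation.Nullary.Negation using (¬_)

-- The vertices are the listed elements of V, not all of V, so that graphs
-- with different vertex sets (a graph and its subgraphs) can share V.

record Graph (V : Set) : Set₁ where
  field
    vertices : List V
    unique   : Unique vertices
    _~_      : Rel V 0ℓ
    _~?_     : Decidable _~_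
    ~-sym    : Symmetric _~_
    ~-irrefl : Irreflexive _≡_ _~_
    ~-vertex : ∀ {u v} → u ~ v → u ∈ vertices

  degree : V → ℕ
  degree v = length (filter (v ~?_) vertices)

  -- The value is 0 for the graph without vertices.
  Δ : ℕ
  Δ = max 0 (map degree vertices)

open Graph public using (Δ)

module _ {V : Set} where

  record _IsSubgraphOf_ (H G : Graph V) : Set where
    private
      module H = Graph H
      module G = Graph G
    field
      vertices-⊆ : ∀ {v} → v ∈ H.vertices → v ∈ G.vertices
      edges-⊆    : ∀ {u v} → u H.~ v → u G.~ v

  -- G −E H is G − E(H).
  _−E_ : Graph V → Graph V → Graph V
  G −E H = record
    { vertices = G.vertices
    ; unique   = G.unique
    ; _~_      = λ u v → u G.~ v × ¬ (u H.~ v)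
    ; _~?_     = λ u v → (u G.~? v) ×-dec ¬? (u H.~? v)
    ; ~-sym    = Product.map G.~-sym (_∘ H.~-sym)
    ; ~-irrefl = λ u≡v → G.~-irrefl u≡v ∘ proj₁
    ; ~-vertex = G.~-vertex ∘ proj₁
    }
    where
    module G = Graph G
    module H = Graph H

  record IsListColouring (G : Graph V) (L : V → List ℕ) (φ : V → ℕ) : Set where
    open Graph G
    field
      fromList : ∀ {v} → v ∈ vertices → φ v ∈ L v
      proper   : ∀ {u v} → u ~ v → φ u ≢ φ v

  Choosable : ℕ → Graph V → Set
  Choosable k G =
    (L : V → List ℕ) →
    (∀ {v} → v ∈ Graph.vertices G → Unique (L v) × length (L v) ≡ k) →
    ∃ λ (φ : V → ℕ) → IsListColouring G L φ

record Finite (V : Set) : Set where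
  field
    _≟_      : DecidableEquality V
    elements : List V
    unique   : Unique elements
    complete : ∀ v → v ∈ elements

finite-Fin : ∀ n → Finite (Fin n)
finite-Fin n = record
  { _≟_      = Fin._≟_
  ; elements = allFin n
  ; unique   = Unique.allFin⁺ n
  ; complete = ∈-allFin
  }

infixr 1 _finite-⊎_
infixr 2 _finite-×_

_finite-⊎_ : ∀ {A B} → Finite A → Finite B → Finite (A ⊎ B)
FA finite-⊎ FB = record
  { _≟_      = Sum.≡-dec A._≟_ B._≟_
  ; elements = map inj₁ A.elements ++ map inj₂ B.elements
  ; unique   = Unique.++⁺ (Unique.map⁺ Sum.inj₁-injective A.unique)
                          (Unique.map⁺ Sum.inj₂-injective B.unique)
                          disjoint
  ; complete = λ
      { (inj₁ x) → ∈-++⁺ˡ (∈-map⁺ inj₁ (A.complete x))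
      ; (inj₂ y) → ∈-++⁺ʳ (map inj₁ A.elements) (∈-map⁺ inj₂ (B.complete y))
      }
  }
  where
  module A = Finite FA
  module B = Finite FB

  disjoint : ∀ {v} → ¬ (v ∈ map inj₁ A.elements × v ∈ map inj₂ B.elements)
  disjoint (v∈A , v∈B) with ∈-map⁻ inj₁ v∈A | ∈-map⁻ inj₂ v∈B
  ... | _ , _ , refl | _ , _ , ()

_finite-×_ : ∀ {A B} → Finite A → Finite B → Finite (A × B)
FA finite-× FB = record
  { _≟_      = Product.≡-dec A._≟_ B._≟_
  ; elements = cartesianProduct A.elements B.elements
  ; unique   = Unique.cartesianProduct⁺ A.unique B.unique
  ; complete = λ (x , y) → ∈-cartesianProduct⁺ (A.complete x) (B.complete y)
  }
  where
  module A = Finite FA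
  module B = Finite FB

-- A pair in the list is an unordered edge; repetitions are irrelevant.

Edges : Set → Set
Edges V = List (V × V)

Loopless : ∀ {V} → Edges V → Set
Loopless = All (uncurry _≢_)

fromEdges : ∀ {V} → Finite V → (es : Edges V) → Loopless es → Graph V
fromEdges finite es loopless = record
  { vertices = elements
  ; unique   = unique
  ; _~_      = λ u v → (u , v) ∈ es ⊎ (v , u) ∈ es
  ; _~?_     = λ u v → ((u , v) ∈? es) ⊎-dec ((v , u) ∈? es)
  ; ~-sym    = Sum.swap
  ; ~-irrefl = λ { refl (inj₁ e) → All.lookup loopless e refl
                 ; refl (inj₂ e) → All.lookup loopless e refl }
  ; ~-vertex = λ {u} _ → complete u
  }
  where
  open Finite finite
  open DecMembership (Product.≡-dec _≟_ _≟_) using (_∈?_)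

-- Take m copies of a graph on Q ⊎ A. In the i-th copy the vertex q of Q (a
-- "root") is identified with the vertex ρ i q of a base graph on R; the
-- vertices in A stay distinct, (i , x) being the i-th copy of x.

module Gluing {Q A R : Set} {m : ℕ} (ρ : Fin m → Q → R) where

  place : Fin m → Q ⊎ A → R ⊎ (Fin m × A)
  place i = Sum.map (ρ i) (i ,_)

  glue : Edges R → Edges (Q ⊎ A) → Edges (R ⊎ (Fin m × A))
  glue base es =
    map (Product.map inj₁ inj₁) base ++
    concatMap (λ i → map (Product.map (place i) (place i)) es) (allFin m)

  module _ (ρ-injective : ∀ i → Injective _≡_ _≡_ (ρ i)) where

    place-injective : ∀ i → Injective _≡_ _≡_ (place i)
    place-injective i {inj₁ _} {inj₁ _} eq
      with refl ← ρ-injective i (Sum.inj₁-injective eq) = refl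
    place-injective i {inj₂ _} {inj₂ _} refl = refl

    glue-loopless : ∀ {base es} → Loopless base → Loopless es →
                    Loopless (glue base es)
    glue-loopless base es =
      All.++⁺ (All.map⁺ (All.map (_∘ Sum.inj₁-injective) base))
        (All.concat⁺ (All.map⁺ (All.universal
          (λ i → All.map⁺ (All.map (_∘ place-injective i) es)) (allFin m))))

J₃-Vertex : Set
J₃-Vertex = Fin 2 ⊎ Fin 9

J₃-finite : Finite J₃-Vertex
J₃-finite = finite-Fin 2 finite-⊎ finite-Fin 9

module J₃-Names where
  pattern a = inj₁ 0F
  pattern b = inj₁ 1F
  pattern c = inj₂ 0F
  pattern d = inj₂ 1F
  pattern e = inj₂ 2F
  pattern f = inj₂ 3F
  pattern g = inj₂ 4F
  pattern h = inj₂ 5F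
  pattern i = inj₂ 6F
  pattern j = inj₂ 7F
  pattern k = inj₂ 8F

module _ where
  open J₃-Names

  J₃-edges : Edges J₃-Vertex
  J₃-edges =
    (a , b) ∷
    (a , c) ∷ (a , d) ∷ (a , e) ∷ (a , f) ∷ (a , g) ∷
    (b , c) ∷ (b , d) ∷ (b , e) ∷ (b , f) ∷ (b , g) ∷
    (c , d) ∷ (d , e) ∷ (e , f) ∷ (f , g) ∷
    (h , a) ∷ (h , d) ∷ (h , e) ∷
    (i , a) ∷ (i , e) ∷ (i , f) ∷
    (j , b) ∷ (j , d) ∷ (j , e) ∷
    (k , b) ∷ (k , e) ∷ (k , f) ∷ []

J₃-loopless : Loopless J₃-edges
J₃-loopless = from-yes (All.all? (λ (u , v) → ¬? (u ≟ v)) J₃-edges)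
  where open Finite J₃-finite

J₃ : Graph J₃-Vertex
J₃ = fromEdges J₃-finite J₃-edges J₃-loopless

-- The roots 0F and 1F are a and b, and inj₂ (t , x) is the vertex inj₂ x of
-- the t-th copy of J₃.

S-Vertex : Set
S-Vertex = Fin 2 ⊎ (Fin 9 × Fin 9)

S-finite : Finite S-Vertex
S-finite = finite-Fin 2 finite-⊎ (finite-Fin 9 finite-× finite-Fin 9)

S-root : Fin 9 → Fin 2 → Fin 2
S-root _ q = q

S-edges : Edges S-Vertex
S-edges = Gluing.glue S-root [] J₃-edges

S-loopless : Loopless S-edges
S-loopless = Gluing.glue-loopless S-root (λ _ eq → eq) [] J₃-loopless

S : Graph S-Vertex
S = fromEdges S-finite S-edges S-loopless

-- The star has centre 0F and leaves 1F, …, 4F, and inj₂ (i , x) is the vertex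
-- inj₂ x of the i-th copy of S.

G₁-Vertex : Set
G₁-Vertex = Fin 5 ⊎ (Fin 4 × (Fin 9 × Fin 9))

G₁-finite : Finite G₁-Vertex
G₁-finite =
  finite-Fin 5 finite-⊎ (finite-Fin 4 finite-× (finite-Fin 9 finite-× finite-Fin 9))

star-edges : Edges (Fin 5)
star-edges = map (λ i → zero , suc i) (allFin 4)

star-loopless : Loopless star-edges
star-loopless = All.map⁺ {f = λ i → zero , suc i} (All.universal (λ _ ()) (allFin 4))

-- In each copy of S the vertex a becomes the centre and b becomes a leaf.
G₁-root : Fin 4 → Fin 2 → Fin 5
G₁-root i 0F = zero
G₁-root i 1F = suc i

G₁-root-injective : ∀ i → Injective _≡_ _≡_ (G₁-root i)
G₁-root-injective i {0F} {0F} _ = refl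
G₁-root-injective i {0F} {1F} ()
G₁-root-injective i {1F} {0F} ()
G₁-root-injective i {1F} {1F} _ = refl

G₁-edges : Edges G₁-Vertex
G₁-edges = Gluing.glue G₁-root star-edges S-edges

G₁-loopless : Loopless G₁-edges
G₁-loopless = Gluing.glue-loopless G₁-root G₁-root-injective star-loopless S-loopless

G₁ : Graph G₁-Vertex
G₁ = fromEdges G₁-finite G₁-edges G₁-loopless

-- Each H-edge at the centre lies in at most one S_i, so some S_i has none of
-- them; of its nine copies of J₃ at least six also avoid the H-edges at b.
-- Giving a and b the list {0,1,2}, there are six pairs (α , β) of distinct
-- colours for them, and each of these six copies is made to block one pair.
--
-- In a copy blocking (α , β), let c, d, f, g have the list {α,β,3}, hence the
-- colour 3. If H misses an edge of the path cdefg, then e gets {α,β,3} as well.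
-- Otherwise e gets {α,β,4}, and h, i get {α,3,4} and j, k get {β,3,4}. Now H
-- uses two edges at each of d, e, f, so it can use at most one more at each;
-- hence one of h, i, j, k keeps all of its edges and has no colour left.
module Submission where

open import Defs
open import Data.Bool.Base using (if_then_else_)
open import Data.Fin.Base using (Fin; zero; suc; toℕ; punchIn; punchOut)
open import Data.Fin.Patterns
import Data.Fin.Properties as Fin
open import Data.List.Base
  using (List; []; _∷_; _++_; map; filter; length; lookup; allFin; cartesianProduct)
open import Data.List.Extrema.Nat using (xs≤max)
import Data.List.Membership.DecPropositional as DecMembership
open import Data.List.Membership.Propositional using (_∈_; lose)
open import Data.List.Membership.Propositional.Properties
  using (∈-allFin; ∈-lookup; ∈-++⁺ˡ; ∈-++⁺ʳ; ∈-map⁺; ∈-map⁻; ∈-filter⁺; ∈-filter⁻;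
         ∈-concatMap⁺; ∈-cartesianProduct⁺)
open import Data.List.Membership.Setoid.Properties using (index-injective)
open import Data.List.Properties using (length-++; length-map; length-tabulate)
open import Data.List.Relation.Binary.Subset.Propositional using (_⊆_)
open import Data.List.Relation.Unary.All as All using (All; []; _∷_)
import Data.List.Relation.Unary.All.Properties as All
open import Data.List.Relation.Unary.AllPairs using ([]; _∷_)
open import Data.List.Relation.Unary.Any using (here; there; index)
open import Data.List.Relation.Unary.Unique.Propositional using (Unique)
open import Data.List.Relation.Unary.Unique.DecPropositional using (unique?)
import Data.List.Relation.Unary.Unique.Propositional.Properties as Unique
open import Data.Nat.Base using (ℕ; _+_; _≤_; s≤s; z≤n)
import Data.Nat.Properties as ℕ
open import Data.Product.Base as Product using (_×_; _,_; ∃; proj₁; proj₂)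
open import Data.Sum.Base as Sum using (_⊎_; inj₁; inj₂)
open import Function.Base using (_∘_; _on_)
open import Function.Definitions using (Injective)
open import Relation.Binary.Definitions using (DecidableEquality)
open import Relation.Binary.PropositionalEquality
  using (_≡_; _≢_; refl; sym; trans; cong; cong₂; subst; setoid)
open import Relation.Nullary.Decidable
  using (does; yes; no; True; toWitness; from-yes; ¬?; _×-dec_; decidable-stable)
open import Relation.Nullary.Negation using (¬_; contradiction)

open Graph using (degree)

-- Counting with lists.

module _ {A : Set} where

  lookup-injective : ∀ {xs : List A} → Unique xs → Injective _≡_ _≡_ (lookup xs)
  lookup-injective (_ ∷ _) {zero} {zero} _ = refl
  lookup-injective (x∉xs ∷ _) {zero} {suc q} eq =
    contradiction eq (All.lookup x∉xs (∈-lookup q))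
  lookup-injective (x∉xs ∷ _) {suc p} {zero} eq =
    contradiction (sym eq) (All.lookup x∉xs (∈-lookup p))
  lookup-injective (_ ∷ xs!) {suc p} {suc q} eq = cong suc (lookup-injective xs! eq)

  -- Sending a position in `xs` to a position of the same entry in `ys` is injective, since `xs` has
  -- no repetitions.
  length-mono-⊆ : ∀ {xs ys : List A} → Unique xs → xs ⊆ ys → length xs ≤ length ys
  length-mono-⊆ {xs} xs! xs⊆ys =
    Fin.injective⇒≤ {f = λ p → index (xs⊆ys (∈-lookup {xs = xs} p))}
      (lookup-injective xs! ∘ index-injective (setoid A) _ _)

  ∈-last : ∀ {v x y z : A} → v ∈ x ∷ y ∷ z ∷ [] → v ≢ x → v ≢ y → v ≡ z
  ∈-last (here v≡x) v≢x _ = contradiction v≡x v≢x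
  ∈-last (there (here v≡y)) _ v≢y = contradiction v≡y v≢y
  ∈-last (there (there (here v≡z))) _ _ = v≡z

  -- Serves to distribute the six colour pairs `ys` over the usable copies `xs` of `J₃`: each pair
  -- gets its own copy, and all remaining copies get the default `y₀`.
  cover : ∀ {B : Set} → DecidableEquality A → B → ∀ {xs : List A} → Unique xs →
          (ys : List B) → length ys ≤ length xs →
          ∃ λ (s : A → B) → ∀ {y} → y ∈ ys → ∃ λ x → x ∈ xs × s x ≡ y
  cover _ y₀ _ [] _ = (λ _ → y₀) , λ ()
  cover {B} _≟_ y₀ {x ∷ _} (x∉xs ∷ xs!) (y ∷ ys) (s≤s ys≤xs) = s′ , λ where
      (here refl) → x , here refl , s′-x
      (there y∈ys) → let z , z∈xs , sz≡y = proj₂ rest y∈ys in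
        z , there z∈xs , trans (s′-other (All.lookup x∉xs z∈xs)) sz≡y
    where
    rest = cover _≟_ y₀ xs! ys ys≤xs

    s′ : A → B
    s′ z = if does (x ≟ z) then y else proj₁ rest z

    s′-x : s′ x ≡ y
    s′-x with x ≟ x
    ... | yes _ = refl
    ... | no x≢x = contradiction refl x≢x

    s′-other : ∀ {z} → x ≢ z → s′ z ≡ proj₁ rest z
    s′-other {z} x≢z with x ≟ z
    ... | yes x≡z = contradiction x≡z x≢z
    ... | no _ = refl

-- Degrees, and labels missed by the neighbours of a vertex.

module _ {V : Set} (G : Graph V) where
  open Graph G using (_~_; _~?_; vertices; ~-vertex; ~-sym)

  neighbours : V → List V
  neighbours u = filter (u ~?_) vertices

  ∈-neighbours : ∀ {u v} → u ~ v → v ∈ neighbours u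
  ∈-neighbours {u} u~v = ∈-filter⁺ (u ~?_) (~-vertex (~-sym u~v)) u~v

  length≤degree : ∀ {u xs} → Unique xs → All (u ~_) xs → length xs ≤ degree G u
  length≤degree xs! u~xs = length-mono-⊆ xs! (∈-neighbours ∘ All.lookup u~xs)

  -- The maximum runs over the listed vertices only; a vertex with a neighbour is listed by
  -- `~-vertex`, and any other has degree 0.
  degree≤Δ : ∀ u → degree G u ≤ Δ G
  degree≤Δ u with neighbours u in eq
  ... | [] = z≤n
  ... | v ∷ vs = subst (λ ws → length ws ≤ Δ G) eq
      (All.lookup (xs≤max 0 (map (degree G) vertices)) (∈-map⁺ (degree G) (~-vertex u~v)))
    where
    u~v : u ~ v
    u~v = proj₂ (∈-filter⁻ (u ~?_) {xs = vertices} (subst (v ∈_) (sym eq) (here refl)))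

  module _ {n} (κ : V → Fin n) where
    open DecMembership (Fin._≟_ {n}) using (_∈?_)

    -- With `κ` the index of the copy in which a vertex lies, these are copies that no edge at `u`
    -- enters.
    unreached : V → List (Fin n)
    unreached u = filter (λ q → ¬? (q ∈? map κ (neighbours u))) (allFin n)

    unreached-unique : ∀ u → Unique (unreached u)
    unreached-unique u = Unique.filter⁺ _ (Unique.allFin⁺ n)

    ∈-unreached : ∀ {u v q} → q ∈ unreached u → u ~ v → κ v ≢ q
    ∈-unreached {u} q∈ u~v refl =
      proj₂ (∈-filter⁻ (λ q → ¬? (q ∈? map κ (neighbours u))) {xs = allFin n} q∈)
        (∈-map⁺ κ (∈-neighbours u~v))

    -- Every label is carried by a neighbour of `u` or is unreached, and the neighbours carry at
    -- most `degree G u` labels.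
    length-unreached : ∀ u → n ≤ degree G u + length (unreached u)
    length-unreached u = begin
      n                                            ≡⟨ length-tabulate {n = n} (λ q → q) ⟨
      length (allFin n)                            ≤⟨ length-mono-⊆ (Unique.allFin⁺ n) split ⟩
      length (reached ++ unreached u)              ≡⟨ length-++ reached ⟩
      length reached + length (unreached u)        ≡⟨ cong (_+ length (unreached u)) (length-map κ (neighbours u)) ⟩
      degree G u + length (unreached u)            ∎
      where
      open ℕ.≤-Reasoning
      reached = map κ (neighbours u)

      split : allFin n ⊆ reached ++ unreached u
      split {q} q∈ with q ∈? reached
      ... | yes q∈reached = ∈-++⁺ˡ q∈reached
      ... | no q∉reached = ∈-++⁺ʳ reached (∈-filter⁺ _ q∈ q∉reached)

-- Restricting H to one copy of `J₃`.

module _ {V W : Set} (finite : Finite W) (G : Graph V) (ι : W → V) where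
  private
    module G = Graph G
    module W = Finite finite

  pullback : Graph W
  pullback = record
    { vertices = W.elements
    ; unique   = W.unique
    ; _~_      = G._~_ on ι
    ; _~?_     = λ u v → ι u G.~? ι v
    ; ~-sym    = G.~-sym
    ; ~-irrefl = G.~-irrefl ∘ cong ι
    ; ~-vertex = λ {u} _ → W.complete u
    }

  -- An injective `ι` maps the neighbours of `u` to distinct neighbours of `ι u`.
  degree-pullback : Injective _≡_ _≡_ ι → ∀ u → degree pullback u ≤ degree G (ι u)
  degree-pullback ι-injective u =
    subst (_≤ degree G (ι u)) (length-map ι (neighbours pullback u))
      (length≤degree G
        (Unique.map⁺ ι-injective (Unique.filter⁺ (λ v → ι u G.~? ι v) W.unique))
        (All.map⁺ (All.all-filter (λ v → ι u G.~? ι v) W.elements)))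

-- Blocking one colour pair in a copy of `J₃`.

palette : List ℕ
palette = map toℕ (allFin 3)

module _ where
  open J₃-Names
  private
    module J₃ = Graph J₃
    module F = Finite J₃-finite

  -- `ε` will be `1F` if H contains the whole path `cdefg`, and `0F` if it misses an edge of it.
  J₃-list : (α β : ℕ) (ε : Fin 2) → J₃-Vertex → List ℕ
  J₃-list α β ε a = palette
  J₃-list α β ε b = palette
  J₃-list α β ε c = α ∷ β ∷ 3 ∷ []
  J₃-list α β ε d = α ∷ β ∷ 3 ∷ []
  J₃-list α β ε e = α ∷ β ∷ 3 + toℕ ε ∷ []
  J₃-list α β ε f = α ∷ β ∷ 3 ∷ []
  J₃-list α β ε g = α ∷ β ∷ 3 ∷ []
  J₃-list α β ε h = α ∷ 3 ∷ 4 ∷ []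
  J₃-list α β ε i = α ∷ 3 ∷ 4 ∷ []
  J₃-list α β ε j = β ∷ 3 ∷ 4 ∷ []
  J₃-list α β ε k = β ∷ 3 ∷ 4 ∷ []

  -- Writing the second colour as `punchIn α q` makes it differ from `α` and leaves a finite check.
  J₃-list-valid : ∀ (α : Fin 3) (q : Fin 2) (ε : Fin 2) (x : Fin 9) →
    let xs = J₃-list (toℕ α) (toℕ (punchIn α q)) ε (inj₂ x) in
    Unique xs × length xs ≡ 3
  J₃-list-valid = from-yes
    (Fin.all? λ (α : Fin 3) → Fin.all? λ (q : Fin 2) → Fin.all? λ ε → Fin.all? λ x →
      let xs = J₃-list (toℕ α) (toℕ (punchIn α q)) ε (inj₂ x) in
      unique? ℕ._≟_ xs ×-dec (length xs ℕ.≟ 3))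

  adjacent : ∀ u v → {True (u J₃.~? v)} → u J₃.~ v
  adjacent u v {uv} = toWitness uv

  spine : Edges J₃-Vertex
  spine = (c , d) ∷ (d , e) ∷ (e , f) ∷ (f , g) ∷ []

  module J₃-Colouring
    (K : Graph J₃-Vertex)
    (a-free : ∀ {v} → ¬ Graph._~_ K a v)
    (b-free : ∀ {v} → ¬ Graph._~_ K b v)
    {ε : Fin 2} {ψ : J₃-Vertex → ℕ}
    (colouring : IsListColouring (J₃ −E K) (J₃-list (ψ a) (ψ b) ε) ψ)
    where
    open Graph K using (_~_; _~?_; ~-sym)
    open IsListColouring colouring

    differ : ∀ {u v} → u J₃.~ v → ¬ u ~ v → ψ u ≢ ψ v
    differ uv u≁v = proper (uv , u≁v)

    apart-a : ∀ v → {True (v J₃.~? a)} → ψ v ≢ ψ a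
    apart-a v {va} = differ (toWitness va) (a-free ∘ ~-sym)

    apart-b : ∀ v → {True (v J₃.~? b)} → ψ v ≢ ψ b
    apart-b v {vb} = differ (toWitness vb) (b-free ∘ ~-sym)

    list : ∀ v → ψ v ∈ J₃-list (ψ a) (ψ b) ε v
    list v = fromList (F.complete v)

    c≡3 : ψ c ≡ 3
    c≡3 = ∈-last (list c) (apart-a c) (apart-b c)

    d≡3 : ψ d ≡ 3
    d≡3 = ∈-last (list d) (apart-a d) (apart-b d)

    e≡3+ε : ψ e ≡ 3 + toℕ ε
    e≡3+ε = ∈-last (list e) (apart-a e) (apart-b e)

    f≡3 : ψ f ≡ 3
    f≡3 = ∈-last (list f) (apart-a f) (apart-b f)

    g≡3 : ψ g ≡ 3
    g≡3 = ∈-last (list g) (apart-a g) (apart-b g)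

    -- Here all of `c`, `d`, `e`, `f`, `g` have colour 3, so an edge of the path outside `K` would
    -- be monochromatic.
    spine-deleted : ε ≡ 0F → All (λ (u , v) → u ~ v) spine
    spine-deleted refl =
      monochromatic c d c≡3 d≡3 ∷ monochromatic d e d≡3 e≡3+ε ∷
      monochromatic e f e≡3+ε f≡3 ∷ monochromatic f g f≡3 g≡3 ∷ []
      where
      monochromatic : ∀ u v → {True (u J₃.~? v)} → ψ u ≡ 3 → ψ v ≡ 3 → u ~ v
      monochromatic u v {uv} u≡3 v≡3 = decidable-stable (u ~? v)
        (λ u≁v → differ (toWitness uv) u≁v (trans u≡3 (sym v≡3)))

    -- Used with `x` one of `d`, `f`, with `y` one of `h`, `i`, `j`, `k`, and with `r` the colour of
    -- the root next to `y`. If `xy` survives, then `y` must have colour 4, which is the colour of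
    -- `e`.
    edge-deleted : ε ≡ 1F → ∀ {x y r} → x J₃.~ y → e J₃.~ y →
                   ψ x ≡ 3 → ψ y ∈ r ∷ 3 ∷ 4 ∷ [] → ψ y ≢ r → x ~ y ⊎ e ~ y
    edge-deleted refl {x} {y} xy ey x≡3 y∈ y≢r with x ~? y | e ~? y
    ... | yes x~y | _ = inj₁ x~y
    ... | no _ | yes e~y = inj₂ e~y
    ... | no x≁y | no e≁y = contradiction (trans e≡3+ε (sym y≡4)) (differ ey e≁y)
      where
      y≡4 : ψ y ≡ 4
      y≡4 = ∈-last y∈ y≢r (λ y≡3 → differ xy x≁y (trans x≡3 (sym y≡3)))

    -- With two path edges at `d`, not both `dh` and `dj` are in `K`, so `eh` or `ej` is; likewise
    -- at `f`, `ei` or `ek` is. Together with `de` and `ef` this gives four edges at `e`.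
    spine-survives : ε ≡ 1F → (∀ u → degree K u ≤ 3) → ¬ All (λ (u , v) → u ~ v) spine
    spine-survives ε≡1 degree≤3 (c~d ∷ d~e ∷ e~f ∷ f~g ∷ []) = absurd at-hj at-ik
      where
      four : ∀ u xs → {True (unique? F._≟_ xs)} → {True (4 ℕ.≤? length xs)} →
             ¬ All (u ~_) xs
      four u xs {xs!} {4≤} u~xs = contradiction
        (ℕ.≤-trans (toWitness 4≤)
          (ℕ.≤-trans (length≤degree K (toWitness xs!) u~xs) (degree≤3 u)))
        λ { (s≤s (s≤s (s≤s ()))) }

      at-hj : e ~ h ⊎ e ~ j
      at-hj with edge-deleted ε≡1 (adjacent d h) (adjacent e h) d≡3 (list h) (apart-a h)
               | edge-deleted ε≡1 (adjacent d j) (adjacent e j) d≡3 (list j) (apart-b j)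
      ... | inj₂ e~h | _ = inj₁ e~h
      ... | inj₁ _ | inj₂ e~j = inj₂ e~j
      ... | inj₁ d~h | inj₁ d~j = contradiction
        (~-sym c~d ∷ d~e ∷ d~h ∷ d~j ∷ []) (four d (c ∷ e ∷ h ∷ j ∷ []))

      at-ik : e ~ i ⊎ e ~ k
      at-ik with edge-deleted ε≡1 (adjacent f i) (adjacent e i) f≡3 (list i) (apart-a i)
               | edge-deleted ε≡1 (adjacent f k) (adjacent e k) f≡3 (list k) (apart-b k)
      ... | inj₂ e~i | _ = inj₁ e~i
      ... | inj₁ _ | inj₂ e~k = inj₂ e~k
      ... | inj₁ f~i | inj₁ f~k = contradiction
        (~-sym e~f ∷ f~g ∷ f~i ∷ f~k ∷ []) (four f (e ∷ g ∷ i ∷ k ∷ []))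

      absurd : e ~ h ⊎ e ~ j → ¬ (e ~ i ⊎ e ~ k)
      absurd (inj₁ e~h) (inj₁ e~i) =
        four e (d ∷ f ∷ h ∷ i ∷ []) (~-sym d~e ∷ e~f ∷ e~h ∷ e~i ∷ [])
      absurd (inj₁ e~h) (inj₂ e~k) =
        four e (d ∷ f ∷ h ∷ k ∷ []) (~-sym d~e ∷ e~f ∷ e~h ∷ e~k ∷ [])
      absurd (inj₂ e~j) (inj₁ e~i) =
        four e (d ∷ f ∷ j ∷ i ∷ []) (~-sym d~e ∷ e~f ∷ e~j ∷ e~i ∷ [])
      absurd (inj₂ e~j) (inj₂ e~k) =
        four e (d ∷ f ∷ j ∷ k ∷ []) (~-sym d~e ∷ e~f ∷ e~j ∷ e~k ∷ [])

  -- The lists are built from the colours that `ψ` itself gives to `a` and `b`, the pair to be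
  -- blocked.
  Blocks : Graph J₃-Vertex → Fin 2 → Set
  Blocks K ε =
    (∀ {v} → ¬ Graph._~_ K a v) → (∀ {v} → ¬ Graph._~_ K b v) →
    ∀ {ψ} → ¬ IsListColouring (J₃ −E K) (J₃-list (ψ a) (ψ b) ε) ψ

  -- `ε` depends on `K` alone, so it can be fixed before the colours of `a` and `b` are known.
  J₃-blocks : (K : Graph J₃-Vertex) → (∀ u → degree K u ≤ 3) → ∃ (Blocks K)
  J₃-blocks K degree≤3 with All.all? (λ (u , v) → Graph._~?_ K u v) spine
  ... | yes deleted = 1F , λ a-free b-free colouring →
    J₃-Colouring.spine-survives K a-free b-free colouring refl degree≤3 deleted
  ... | no ¬deleted = 0F , λ a-free b-free colouring →
    ¬deleted (J₃-Colouring.spine-deleted K a-free b-free colouring refl)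

-- The copies of `J₃` in `G₁` and the lists on `G₁`.

module _ {Q A R : Set} {m : ℕ} (ρ : Fin m → Q → R) where
  open Gluing {A = A} ρ

  glue-edge : ∀ {base es u v} p → (u , v) ∈ es → (place p u , place p v) ∈ glue base es
  glue-edge {base} p uv∈es = ∈-++⁺ʳ (map (Product.map inj₁ inj₁) base)
    (∈-concatMap⁺ _
      (lose (∈-allFin p) (∈-map⁺ (Product.map (place p) (place p)) uv∈es)))

embed : Fin 4 → Fin 9 → J₃-Vertex → G₁-Vertex
embed s t = Gluing.place G₁-root s ∘ Gluing.place S-root t

embed-injective : ∀ s t → Injective _≡_ _≡_ (embed s t)
embed-injective s t =
  Gluing.place-injective S-root (λ _ eq → eq) t ∘
  Gluing.place-injective G₁-root G₁-root-injective s

embed-edge : ∀ s t {u v} → (u , v) ∈ J₃-edges → (embed s t u , embed s t v) ∈ G₁-edges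
embed-edge s t = glue-edge G₁-root {base = star-edges} s ∘ glue-edge S-root {base = []} t

-- The value at the centre is junk.
S-index : G₁-Vertex → Fin 4
S-index (inj₁ zero) = zero
S-index (inj₁ (suc s)) = s
S-index (inj₂ (s , _)) = s

-- The value at the roots is junk.
J₃-index : G₁-Vertex → Fin 9
J₃-index (inj₁ _) = zero
J₃-index (inj₂ (_ , t , _)) = t

centre : G₁-Vertex
centre = inj₁ zero

leaf : Fin 4 → G₁-Vertex
leaf s = inj₁ (suc s)

-- The pair (α , q) : Fin 3 × Fin 2 encodes the distinct colours α and punchIn α q.
G₁-list : (Fin 9 → Fin 3 × Fin 2) → (Fin 9 → Fin 2) → G₁-Vertex → List ℕ
G₁-list pair ε (inj₁ _) = palette
G₁-list pair ε (inj₂ (_ , t , x)) =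
  J₃-list (toℕ (proj₁ (pair t))) (toℕ (punchIn (proj₁ (pair t)) (proj₂ (pair t))))
    (ε t) (inj₂ x)

G₁-list-valid : ∀ pair ε v → Unique (G₁-list pair ε v) × length (G₁-list pair ε v) ≡ 3
G₁-list-valid pair ε (inj₁ _) = Unique.map⁺ Fin.toℕ-injective (Unique.allFin⁺ 3) , refl
G₁-list-valid pair ε (inj₂ (_ , t , x)) =
  J₃-list-valid (proj₁ (pair t)) (proj₂ (pair t)) (ε t) x

G₁-list-embed : ∀ pair ε s {t α q} v → pair t ≡ (α , q) →
  G₁-list pair ε (embed s t v) ≡ J₃-list (toℕ α) (toℕ (punchIn α q)) (ε t) v
G₁-list-embed pair ε s (inj₁ 0F) _ = refl
G₁-list-embed pair ε s (inj₁ 1F) _ = refl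
G₁-list-embed pair ε s (inj₂ _) refl = refl

copy : Graph G₁-Vertex → Fin 4 → Fin 9 → Graph J₃-Vertex
copy H s t = pullback J₃-finite H (embed s t)

-- No list colouring, given a copy of `S` without H-edges at the centre.

module _
  (H : Graph G₁-Vertex)
  {s : Fin 4} (s∈ : s ∈ unreached H S-index centre)
  (ε : Fin 9 → Fin 2)
  (blocks : ∀ t → Blocks (copy H s t) (ε t))
  (pair : Fin 9 → Fin 3 × Fin 2)
  (assigned : ∀ p → ∃ λ t → t ∈ unreached H J₃-index (leaf s) × pair t ≡ p)
  where
  open Graph H using (_~_; ~-sym; ~-irrefl)
  open J₃-Names using (a; b)

  -- The leaf and the inner vertices of the chosen copy of `S` all have `S-index` equal to `s`, a
  -- label missed by the H-neighbours of the centre.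
  a-free : ∀ t {v} → ¬ Graph._~_ (copy H s t) a v
  a-free t {a} centre~v = ~-irrefl refl centre~v
  a-free t {b} centre~v = ∈-unreached H S-index s∈ centre~v refl
  a-free t {inj₂ _} centre~v = ∈-unreached H S-index s∈ centre~v refl

  b-free : ∀ {t} → t ∈ unreached H J₃-index (leaf s) → ∀ {v} → ¬ Graph._~_ (copy H s t) b v
  b-free {t} t∈ {a} leaf~v = a-free t {b} (~-sym leaf~v)
  b-free t∈ {b} leaf~v = ~-irrefl refl leaf~v
  b-free t∈ {inj₂ _} leaf~v = ∈-unreached H J₃-index t∈ leaf~v refl

  uncolourable : ∀ {φ} → ¬ IsListColouring (G₁ −E H) (G₁-list pair ε) φ
  uncolourable {φ} colouring =
    let α , _ , centre≡α = ∈-map⁻ toℕ (list centre)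
        β , _ , leaf≡β = ∈-map⁻ toℕ (list (leaf s))
    in blocked centre≡α leaf≡β
    where
    open IsListColouring colouring

    list : ∀ v → φ v ∈ G₁-list pair ε v
    list v = fromList (Finite.complete G₁-finite v)

    centre≢leaf : φ centre ≢ φ (leaf s)
    -- All nine copies share the edge `ab`, the first of `J₃-edges`; copy `zero` is an arbitrary
    -- choice.
    centre≢leaf = proper (inj₁ (embed-edge s zero (here refl)) , a-free zero {b})

    blocked-by : ∀ {α q t} → φ centre ≡ toℕ α → φ (leaf s) ≡ toℕ (punchIn α q) →
                 t ∈ unreached H J₃-index (leaf s) → ¬ pair t ≡ (α , q)
    blocked-by {α} {q} {t} centre≡α leaf≡β t∈ pair≡ =
      blocks t (λ {v} → a-free t {v}) (λ {v} → b-free t∈ {v}) {φ ∘ embed s t} record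
        { fromList = λ {v} _ → subst (φ (embed s t v) ∈_) (lists-agree v) (list (embed s t v))
        ; proper   = λ (uv , u≁v) →
                       proper (Sum.map (embed-edge s t) (embed-edge s t) uv , u≁v)
        }
      where
      lists-agree : ∀ v → G₁-list pair ε (embed s t v) ≡
                    J₃-list (φ centre) (φ (leaf s)) (ε t) v
      lists-agree v = trans (G₁-list-embed pair ε s v pair≡)
        (sym (cong₂ (λ x y → J₃-list x y (ε t) v) centre≡α leaf≡β))

    blocked : ∀ {α β} → φ centre ≡ toℕ α → φ (leaf s) ≢ toℕ β
    blocked {α} {β} centre≡α leaf≡β =
      -- `punchOut` recovers the code of `β` relative to `α`, and hence the copy that blocks this
      -- pair.
      let _ , t∈ , pair≡ = assigned (α , punchOut α≢β) in
      blocked-by centre≡α (trans leaf≡β (sym (cong toℕ (Fin.punchIn-punchOut α≢β)))) t∈ pair≡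
      where
      α≢β : α ≢ β
      α≢β α≡β = centre≢leaf (trans centre≡α (trans (cong toℕ α≡β) (sym leaf≡β)))

-- Choosing the copy of `S` and the lists.

theorem5 : (H : Graph G₁-Vertex) → H IsSubgraphOf G₁ → Δ H ≤ 3 → ¬ Choosable 3 (G₁ −E H)
theorem5 H _ Δ≤3 choosable =
  let s , s∈ = some-unreached
      pair , pair-onto = cover Fin._≟_ (zero , zero)
        (unreached-unique H J₃-index (leaf s)) (cartesianProduct (allFin 3) (allFin 2))
        -- Nine copies minus at most three reached from the leaf leave six, as many as the pairs in
        -- `Fin 3 × Fin 2`.
        (ℕ.+-cancelˡ-≤ 3 6 _ (3+length-unreached J₃-index (leaf s)))
      ε = λ t → proj₁ (J₃-blocks (copy H s t) (copy-degree≤3 s t))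
      _ , colouring = choosable (G₁-list pair ε) (λ {v} _ → G₁-list-valid pair ε v)
  in uncolourable H s∈ ε (λ t → proj₂ (J₃-blocks (copy H s t) (copy-degree≤3 s t)))
       pair (λ (α , q) → pair-onto (∈-cartesianProduct⁺ (∈-allFin α) (∈-allFin q))) colouring
  where
  degree≤3 : ∀ u → degree H u ≤ 3
  degree≤3 u = ℕ.≤-trans (degree≤Δ H u) Δ≤3

  copy-degree≤3 : ∀ s t u → degree (copy H s t) u ≤ 3
  copy-degree≤3 s t u = ℕ.≤-trans
    (degree-pullback J₃-finite H (embed s t) (embed-injective s t) u) (degree≤3 (embed s t u))

  3+length-unreached : ∀ {n} (κ : G₁-Vertex → Fin n) u → n ≤ 3 + length (unreached H κ u)
  3+length-unreached κ u =
    ℕ.≤-trans (length-unreached H κ u) (ℕ.+-monoˡ-≤ _ (degree≤3 u))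

  some-unreached : ∃ λ s → s ∈ unreached H S-index centre
  -- Four copies of `S` minus at most three reached from the centre leave one.
  some-unreached = head-∈ (ℕ.+-cancelˡ-≤ 3 1 _ (3+length-unreached S-index centre))
    where
    head-∈ : ∀ {A : Set} {xs : List A} → 1 ≤ length xs → ∃ (_∈ xs)
    head-∈ {xs = x ∷ _} _ = x , here refl
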